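{- Let $\mathbb X$ and $\mathbb Y$ be $L$-structures with $|X|=|Y|=\kappa\ge\omega$. Then: (I) The following are equivalent: (a) $\mathbb X\preccurlyeq_c\mathbb Y$; (b) there exists a $\kappa$-closed back and forth system $\Pi\subseteq\mathrm{PC}(\mathbb X,\mathbb Y)$; (c) player II has a winning strategy in the game $G^{\preccurlyeq_c}_\kappa(\mathbb X,\mathbb Y)$. (II) The following are equivalent: (a) $\mathbb X\sim_c\mathbb Y$; (b) there are $\kappa$-closed back and forth systems $\Pi_{\mathbb X,\mathbb Y}\subseteq\mathrm{PC}(\mathbb X,\mathbb Y)$ and $\Pi_{\mathbb Y,\mathbb X}\subseteq\mathrm{PC}(\mathbb Y,\mathbb X)$; (c) player II has winning strategies in both games $G^{\preccurlyeq_c}_\kappa(\mathbb X,\mathbb Y)$ and $G^{\preccurlyeq_c}_\kappa(\mathbb Y,\mathbb X)$.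
   Context: $L=\langle R_i:i\in I\rangle$ is a relational language, $R_i$ of arity $n_i$; for an $L$-structure $\mathbb X$ with domain $X$, $R_i^{\mathbb X}$ is the interpretation of $R_i$. For a map $f$ and tuple $\bar x=\langle x_0,\dots,x_{k-1}\rangle$ write $f\bar x=\langle f(x_0),\dots,f(x_{k-1})\rangle$. A partial condensation from $\mathbb X$ to $\mathbb Y$ is a bijection $f$ from a set $\operatorname{dom}f\subseteq X$ onto a set $\operatorname{ran}f\subseteq Y$ such that for all $i\in I$ and $\bar x\in(\operatorname{dom}f)^{n_i}$, $\bar x\in R_i^{\mathbb X}$ implies $f\bar x\in R_i^{\mathbb Y}$; $\mathrm{PC}(\mathbb X,\mathbb Y)$ is the set of these. A condensation is a partial condensation with domain $X$ and range $Y$ (a bijective homomorphism). $\mathbb X\preccurlyeq_c\mathbb Y$ means there is a condensation from $\mathbb X$ onto $\mathbb Y$; $\mathbb X\sim_c\mathbb Y$ means $\mathbb X\preccurlyeq_c\mathbb Y$ and $\mathbb Y\preccurlyeq_c\mathbb X$. A back and forth system (b.f.s.) is a nonempty $\Pi\subseteq\mathrm{PC}(\mathbb X,\mathbb Y)$ such that (e1) for all $f\in\Pi$ and $x\in X$ there is $g\in\Pi$ with $f\subseteq g$ and $x\in\operatorname{dom}g$, and (e2) for all $f\in\Pi$ and $y\in Y$ there is $g\in\Pi$ with $f\subseteq g$ and $y\in\operatorname{ran}g$. A partial order $\langle P,\le\rangle$ is $\kappa$-closed if for every ordinal $\gamma<\kappa$ and every sequence $\langle p_\alpha:\alpha<\gamma\rangle$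 in $P$ with $p_\beta\le p_\alpha$ whenever $\alpha<\beta<\gamma$, there is $p\in P$ with $p\le p_\alpha$ for all $\alpha<\gamma$. A b.f.s. $\Pi$ is $\kappa$-closed if $\langle\Pi,\supseteq\rangle$ is $\kappa$-closed. For a cardinal $\kappa$, the game $G^{\preccurlyeq_c}_\kappa(\mathbb X,\mathbb Y)$ has steps indexed by $\alpha<\kappa$; at step $\alpha$ player I either chooses $x_\alpha\in X$ and then player II chooses $y_\alpha\in Y$, or player I chooses $y_\alpha\in Y$ and then II chooses $x_\alpha\in X$. Player II wins the play iff $\{\langle x_\alpha,y_\alpha\rangle:\alpha<\kappa\}\in\mathrm{PC}(\mathbb X,\mathbb Y)$; otherwise I wins. A strategy for II determines its move from the sequence of previous moves and I's current choice; it is winning if II wins every play in which it is followed. -}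

module Defs where

open import Data.Nat using (ℕ)
open import Data.Product using (Σ; ∃; _×_; _,_; proj₁; proj₂; swap)
open import Data.Refinement using (Refinement-syntax; value)
open import Data.Sum using (_⊎_; inj₁; inj₂)
open import Data.Vec using (Vec)
open import Data.Vec.Relation.Binary.Pointwise.Inductive using (Pointwise)
open import Function using (_∘_; id; _⤖_; _↣_)
open import Induction.WellFounded using (WellFounded)
open import Level using (Level; suc)
open import Relation.Binary using (REL; Rel; Poset; IsStrictTotalOrder; _⇒_)
open import Relation.Binary.PropositionalEquality using (_≡_)
open import Relation.Nullary using (¬_)
open import Relation.Unary using (Pred; _∈_; _⊆_; Satisfiable)

-- A cardinal is an initial ordinal: a well-order in bijection with none of its
-- proper initial segments.  As with von Neumann ordinals, the ordinals γ < κ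
-- are represented by the elements of κ, and γ itself by the segment below γ.
-- (Membership proofs in a segment are irrelevant, so that a segment really is
-- a subset.)
record Cardinal (ℓ : Level) : Set (suc ℓ) where
  infix 4 _<_
  field
    Carrier            : Set ℓ
    _<_                : Rel Carrier ℓ
    isStrictTotalOrder : IsStrictTotalOrder _≡_ _<_
    wellFounded        : WellFounded _<_

  Segment : Carrier → Set ℓ
  Segment γ = [ α ∈ Carrier ∣ α < γ ]

  field
    initial : ∀ γ → ¬ (Carrier ⤖ Segment γ)

∥_∥≡_ : ∀ {ℓ} → Set ℓ → Cardinal ℓ → Set ℓ
∥ X ∥≡ κ = X ⤖ Cardinal.Carrier κ

ω≤_ : ∀ {ℓ} → Cardinal ℓ → Set ℓ
ω≤ κ = ℕ ↣ Cardinal.Carrier κ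

Closed : ∀ {ℓ c ℓ₁ ℓ₂} → Cardinal ℓ → Poset c ℓ₁ ℓ₂ → Set _
Closed κ P =
  ∀ (γ : K.Carrier) (p : K.Segment γ → P.Carrier) →
  (∀ α β → value α K.< value β → p β P.≤ p α) →
  ∃ λ q → ∀ α → q P.≤ p α
  where
  module K = Cardinal κ
  module P = Poset P

record Language (ℓ : Level) : Set (suc ℓ) where
  field
    Index : Set ℓ
    arity : Index → ℕ

record Structure {ℓ} (L : Language ℓ) : Set (suc ℓ) where
  open Language L
  field
    Carrier : Set ℓ
    rel     : (i : Index) → Pred (Vec Carrier (arity i)) ℓ

module _ {ℓ} {X Y : Set ℓ} where

  dom : REL X Y ℓ → Pred X ℓ
  dom f x = ∃ λ y → f x y

  ran : REL X Y ℓ → Pred Y ℓ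
  ran f y = ∃ λ x → f x y

  -- The order ⟨Π, ⊇⟩: larger partial maps are smaller elements.
  reverseInclusion : Pred (REL X Y ℓ) ℓ → Poset (suc ℓ) ℓ ℓ
  reverseInclusion Π = record
    { Carrier = Σ (REL X Y ℓ) Π
    ; _≈_     = λ (f , _) (g , _) → (g ⇒ f) × (f ⇒ g)
    ; _≤_     = λ (f , _) (g , _) → g ⇒ f
    ; isPartialOrder = record
      { isPreorder = record
        { isEquivalence = record
          { refl  = id , id
          ; sym   = swap
          ; trans = λ (p , q) (r , s) → (λ u → p (r u)) , (λ u → s (q u))
          }
        ; reflexive = proj₁
        ; trans     = λ p q u → p (q u)
        }
      ; antisym = _,_
      }
    }

module _ {ℓ} {L : Language ℓ} (𝕏 𝕐 : Structure L) where
  open Language L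
  private
    module X = Structure 𝕏
    module Y = Structure 𝕐

  -- Partial maps are given by their graphs; Pointwise f xs ys says that xs is a
  -- tuple in dom f and ys = f xs.
  record PC (f : REL X.Carrier Y.Carrier ℓ) : Set ℓ where
    field
      functional : ∀ {x y y′} → f x y → f x y′ → y ≡ y′
      injective  : ∀ {x x′ y} → f x y → f x′ y → x ≡ x′
      preserves  : ∀ i {xs ys} → Pointwise f xs ys → xs ∈ X.rel i → ys ∈ Y.rel i

  Condensation : Pred (REL X.Carrier Y.Carrier ℓ) ℓ
  Condensation f = PC f × (∀ x → x ∈ dom f) × (∀ y → y ∈ ran f)

  infix 4 _≼c_

  _≼c_ : Set (suc ℓ)
  _≼c_ = ∃ Condensation

  record BackAndForth (Π : Pred (REL X.Carrier Y.Carrier ℓ) ℓ) : Set (suc ℓ) where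
    field
      nonempty : Satisfiable Π
      ⊆PC      : Π ⊆ PC
      forth    : ∀ {f} → f ∈ Π → ∀ x → ∃ λ g → g ∈ Π × (f ⇒ g) × x ∈ dom g
      back     : ∀ {f} → f ∈ Π → ∀ y → ∃ λ g → g ∈ Π × (f ⇒ g) × y ∈ ran g

  ClosedBackAndForth : Cardinal ℓ → Pred (Pred (REL X.Carrier Y.Carrier ℓ) ℓ) (suc ℓ)
  ClosedBackAndForth κ Π = BackAndForth Π × Closed κ (reverseInclusion Π)

  module Game (κ : Cardinal ℓ) where
    private module K = Cardinal κ

    MoveI : Set ℓ
    MoveI = X.Carrier ⊎ Y.Carrier

    MoveII : MoveI → Set ℓ
    MoveII (inj₁ _) = Y.Carrier
    MoveII (inj₂ _) = X.Carrier

    Step : Set ℓ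
    Step = Σ MoveI MoveII

    pair : Step → X.Carrier × Y.Carrier
    pair (inj₁ x , y) = x , y
    pair (inj₂ y , x) = x , y

    Play : Set ℓ
    Play = K.Carrier → Step

    graph : Play → REL X.Carrier Y.Carrier ℓ
    graph p x y = ∃ λ α → pair (p α) ≡ (x , y)

    IIWins : Pred Play ℓ
    IIWins p = PC (graph p)

    Strategy : Set ℓ
    Strategy = ∀ α → (K.Segment α → Step) → (m : MoveI) → MoveII m

    Follows : Strategy → Pred Play ℓ
    Follows σ p = ∀ α → proj₂ (p α) ≡ σ α (p ∘ value) (proj₁ (p α))

    Winning : Pred Strategy ℓ
    Winning σ = Follows σ ⊆ IIWins

infix 4 _∼c_

_∼c_ : ∀ {ℓ} {L : Language ℓ} → Structure L → Structure L → Set (suc ℓ)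
𝕏 ∼c 𝕐 = (𝕏 ≼c 𝕐) × (𝕐 ≼c 𝕏)

{-# OPTIONS --safe #-}

-- A condensation forms a closed back and forth system by itself. Given any
-- such system, II descends through it along the moves of I: at step α she
-- takes a lower bound of the earlier partial maps, extends it by forth or back
-- and reads off her answer; the played pairs then lie in a directed union of
-- members of the system. Conversely, κ + κ = κ lets I play every element of X
-- and of Y, so that a play won by II against it is a condensation.
module Submission where

open import Defs
open import Axiom.ExcludedMiddle using (ExcludedMiddle)
open import Axiom.Extensionality.Propositional using (Extensionality; lower-extensionality)
open import Data.Irrelevant using ([_])
open import Data.Nat using (ℕ; zero; _+_)
open import Data.Nat.Properties using (m≢1+m+n; +-cancelˡ-≡)
open import Data.Product using (Σ; ∃; _×_; _,_; proj₁; proj₂; uncurry)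
open import Data.Product.Function.NonDependent.Propositional using (_×-⇔_)
open import Data.Refinement using (value; value-injective; _,_)
open import Data.Sum as Sum using (_⊎_; inj₁; inj₂)
open import Data.Vec.Relation.Binary.Pointwise.Inductive as Pointwise using (Pointwise; []; _∷_)
open import Function using (_⇔_; _∘_; mk⤖; mk⇔; Inverse; Injection)
open import Function.Definitions using (Injective; StrictlySurjective)
open import Function.Properties.Bijection using (⤖⇒↔)
open import Function.Consequences.Propositional using (strictlySurjective⇒surjective)
open import Induction.WellFounded using (module All; module FixPoint)
open import Level using (Level; suc; Lift; lift; lower)
open import Relation.Binary using (REL; Rel; IsStrictTotalOrder; tri<; tri≈; tri>; _⇒_)
open import Relation.Binary.PropositionalEquality using (_≡_; _≢_; refl; sym; trans; cong; subst)
open import Relation.Nullary using (Dec; yes; no; ¬_; contradiction; recompute)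
open import Relation.Nullary.Decidable using (map′)
open import Relation.Unary using (Pred)

private variable
  ℓ : Level

-- Hilbert's hotel on a set that contains a copy of the natural numbers.

module _ (em : ExcludedMiddle ℓ) {A : Set ℓ} (ι : ℕ → A) (ι-injective : Injective _≡_ _≡_ ι) where

  private
    -- The decision is a separate argument, so that equations can be proved by cases on it,
    -- whichever proof `em` returns.
    shiftDec : (a : A) → Dec (∃ λ n → ι n ≡ a) → A
    shiftDec a (yes (n , _)) = ι (ℕ.suc n)
    shiftDec a (no _)        = a

    shiftDec-ι : ∀ {a} n (d : Dec (∃ λ n → ι n ≡ a)) → ι n ≡ a → shiftDec a d ≡ ι (ℕ.suc n)
    shiftDec-ι n (yes (m , ιm≡a)) ιn≡a =
      cong (ι ∘ ℕ.suc) (ι-injective (trans ιm≡a (sym ιn≡a)))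
    shiftDec-ι n (no ∄n)          ιn≡a = contradiction (n , ιn≡a) ∄n

  hilbertShift : A → A
  hilbertShift a = shiftDec a em

  hilbertShift-injective : Injective _≡_ _≡_ hilbertShift
  hilbertShift-injective {a} {b} eq with em {∃ λ n → ι n ≡ a} | em {∃ λ n → ι n ≡ b}
  ... | yes (m , refl) | yes (n , refl) with refl ← ι-injective eq = refl
  ... | yes (m , _)    | no ∄n          = contradiction (ℕ.suc m , eq) ∄n
  ... | no ∄m          | yes (n , _)    = contradiction (ℕ.suc n , sym eq) ∄m
  ... | no _           | no _           = eq

  hilbertShift-avoids : ∀ a → hilbertShift a ≢ ι 0
  hilbertShift-avoids a eq with em {∃ λ n → ι n ≡ a}
  ... | yes (n , _) = contradiction (ι-injective eq) λ ()
  ... | no ∄n       = ∄n (0 , sym eq)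

  hilbertShift-onto : ∀ b → b ≢ ι 0 → ∃ λ a → hilbertShift a ≡ b
  hilbertShift-onto b b≢ι0 with em {∃ λ n → ι n ≡ b}
  ... | yes (zero , ι0≡b)    = contradiction (sym ι0≡b) b≢ι0
  ... | yes (ℕ.suc n , ιsn≡b) = ι n , trans (shiftDec-ι n em refl) ιsn≡b
  ... | no ∄n                 = b , fixed em
    where
    fixed : (d : Dec (∃ λ n → ι n ≡ b)) → shiftDec b d ≡ b
    fixed (yes ∃n) = contradiction ∃n ∄n
    fixed (no _)   = refl

module _ (em : ExcludedMiddle ℓ) {A : Set ℓ} (ι : ℕ → A) (ι-injective : Injective _≡_ _≡_ ι) where

  -- Lets a prescribed element be the one that the shift misses. The point `a` is put in front of a
  -- tail of `ι` that starts just after the index where `ι` takes the value `a`, if there is one.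
  rebase : ∀ a → ∃ λ (ι′ : ℕ → A) → Injective _≡_ _≡_ ι′ × ι′ 0 ≡ a
  rebase a with tail
    where
    tail : ∃ λ c → ∀ m → ι (c + m) ≢ a
    tail with em {∃ λ n → ι n ≡ a}
    ... | yes (n , refl) = ℕ.suc n , λ m eq → m≢1+m+n n (sym (ι-injective eq))
    ... | no ∄n          = 0 , λ m eq → ∄n (m , eq)
  ... | c , avoids = ι′ , ι′-injective , refl
    where
    ι′ : ℕ → A
    ι′ zero      = a
    ι′ (ℕ.suc n) = ι (c + n)

    ι′-injective : Injective _≡_ _≡_ ι′
    ι′-injective {zero}    {zero}    _  = refl
    ι′-injective {zero}    {ℕ.suc n} eq = contradiction (sym eq) (avoids n)
    ι′-injective {ℕ.suc m} {zero}    eq = contradiction eq (avoids m)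
    ι′-injective {ℕ.suc m} {ℕ.suc n} eq = cong ℕ.suc (+-cancelˡ-≡ c m n (ι-injective eq))

-- Recursion over the initial segments of a cardinal.

module _ (κ : Cardinal ℓ) where
  open Cardinal κ
  open IsStrictTotalOrder isStrictTotalOrder using (compare; _<?_)

  -- Membership in a segment is irrelevant, but the order is decidable, so a usable proof can be
  -- recomputed.
  value< : ∀ {γ} (α : Segment γ) → value α < γ
  value< {γ} (α , [ α<γ ]) = recompute (α <? γ) α<γ

  module SegmentRecursion {a} {A : Set a} (ext : Extensionality ℓ a)
                          (step : ∀ α → (Segment α → A) → A) where
    private
      stepWf : ∀ α → (∀ {β} → β < α → A) → A
      stepWf α ih = step α λ β → ih (value< β)

    rec : Carrier → A
    rec = All.wfRec wellFounded a (λ _ → A) stepWf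

    -- The step must respect pointwise equal histories; extensionality on the segment provides this.
    rec-unfold : ∀ α → rec α ≡ step α (rec ∘ value)
    rec-unfold α = FixPoint.unfold-wfRec wellFounded (λ _ → A) stepWf
      λ α eq → cong (step α) (ext λ β → eq (value< β))

  -- A surjection from κ onto κ + κ.

  module Doubling (em : ExcludedMiddle ℓ) (infinite : ω≤ κ) where
    open IsStrictTotalOrder isStrictTotalOrder using (irrefl)

    least : (P : Pred Carrier ℓ) → ∃ P → ∃ λ α → P α × (∀ {β} → P β → ¬ β < α)
    least P (α , Pα) = All.wfRec wellFounded ℓ
      (λ α → P α → ∃ λ α → P α × (∀ {β} → P β → ¬ β < α)) descend α Pα
      where
      descend : ∀ α → (∀ {β} → β < α → P β → ∃ λ α → P α × (∀ {β} → P β → ¬ β < α)) →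
                P α → ∃ λ α → P α × (∀ {β} → P β → ¬ β < α)
      descend α ih Pα with em {∃ λ β → P β × β < α}
      ... | yes (β , Pβ , β<α) = ih β<α Pβ
      ... | no ∄β              = α , Pα , λ Pβ β<α → ∄β (_ , Pβ , β<α)

    -- With a maximum μ, Hilbert's hotel maps κ onto the segment below μ.
    unbounded : ∀ μ → ∃ λ α → μ < α
    unbounded μ with em {∃ λ α → μ < α}
    ... | yes ∃α = ∃α
    ... | no ∄α with rebase em (Injection.to infinite) (Injection.injective infinite) μ
    ...   | ι , ι-injective , refl = contradiction (mk⤖ (shift-injective , shift-surjective)) (initial μ)
      where
      ≢⇒< : ∀ {α} → α ≢ μ → α < μ
      ≢⇒< {α} α≢μ with compare α μ
      ... | tri< α<μ _ _ = α<μ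
      ... | tri≈ _ α≡μ _ = contradiction α≡μ α≢μ
      ... | tri> _ _ μ<α = contradiction (α , μ<α) ∄α

      shift : Carrier → Segment μ
      shift α = hilbertShift em ι ι-injective α , [ ≢⇒< (hilbertShift-avoids em ι ι-injective α) ]

      shift-injective : Injective _≡_ _≡_ shift
      shift-injective eq = hilbertShift-injective em ι ι-injective (cong value eq)

      shift-surjective : ∀ β → ∃ λ α → ∀ {α′} → α′ ≡ α → shift α′ ≡ β
      shift-surjective = strictlySurjective⇒surjective λ β →
        let α , eq = hilbertShift-onto em ι ι-injective (value β)
                       (λ β≡μ → irrefl β≡μ (value< β))
        in α , value-injective eq

    -- The ordinal successor, total because an infinite cardinal is a limit.
    next : Carrier → Carrier
    next α = proj₁ (least (α <_) (unbounded α))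

    <-next : ∀ α → α < next α
    <-next α = proj₁ (proj₂ (least (α <_) (unbounded α)))

    next-least : ∀ {α β} → α < β → ¬ β < next α
    next-least {α} = proj₂ (proj₂ (least (α <_) (unbounded α)))

    next-injective : Injective _≡_ _≡_ next
    next-injective {α} {β} eq with compare α β
    ... | tri< α<β _ _ = contradiction (subst (β <_) (sym eq) (<-next β)) (next-least α<β)
    ... | tri≈ _ α≡β _ = α≡β
    ... | tri> _ _ β<α = contradiction (subst (α <_) eq (<-next α)) (next-least β<α)

    private
      advance : Carrier ⊎ Carrier → Carrier ⊎ Carrier
      advance (inj₁ γ) = inj₂ γ
      advance (inj₂ γ) = inj₁ (next γ)

      splitDec : ∀ α → Dec (∃ λ β → next β ≡ α) →
                 (∀ {β} → β < α → Carrier ⊎ Carrier) → Carrier ⊎ Carrier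
      splitDec α (yes (β , refl)) ih = advance (ih (<-next β))
      -- Zero and limits open a new block, whose first label is the ordinal itself.
      splitDec α (no _)           ih = inj₁ α

      splitDec-ext : ∀ α d {ih ih′ : ∀ {β} → β < α → Carrier ⊎ Carrier} →
                     (∀ {β} β<α → ih {β} β<α ≡ ih′ β<α) → splitDec α d ih ≡ splitDec α d ih′
      splitDec-ext α (yes (β , refl)) eq = cong advance (eq (<-next β))
      splitDec-ext α (no _)           eq = refl

      splitDec-next : ∀ {α β} d (f : Carrier → Carrier ⊎ Carrier) → next β ≡ α →
                      splitDec α d (λ {β} _ → f β) ≡ advance (f β)
      splitDec-next (yes (β , refl)) f eq = cong (advance ∘ f) (sym (next-injective eq))
      splitDec-next (no ∄β)          f eq = contradiction (_ , eq) ∄β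

      splitDec-limit : ∀ {α} d (ih : ∀ {β} → β < α → Carrier ⊎ Carrier) →
                       ¬ (∃ λ β → next β ≡ α) → splitDec α d ih ≡ inj₁ α
      splitDec-limit (yes ∃β) ih ∄β = contradiction ∃β ∄β
      splitDec-limit (no _)   ih ∄β = refl

    -- For λ zero or a limit, split (λ + 2n) = inj₁ (λ + n) and
    -- split (λ + 2n + 1) = inj₂ (λ + n).
    split : Carrier → Carrier ⊎ Carrier
    split = All.wfRec wellFounded ℓ _ λ α → splitDec α em

    split-unfold : ∀ α → split α ≡ splitDec α em λ {β} _ → split β
    split-unfold α = FixPoint.unfold-wfRec wellFounded _ (λ α → splitDec α em)
      λ α → splitDec-ext α em

    split-next : ∀ {β c} → split β ≡ c → split (next β) ≡ advance c
    split-next {β} refl = trans (split-unfold (next β)) (splitDec-next em split refl)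

    -- Labels advance once every two positions: a successor label is met two steps after its
    -- predecessor, and a label that is zero or a limit at its own position.
    split-inj₁ : ∀ γ → ∃ λ α → split α ≡ inj₁ γ
    split-inj₁ = All.wfRec wellFounded ℓ (λ γ → ∃ λ α → split α ≡ inj₁ γ) reach
      where
      reach : ∀ γ → (∀ {δ} → δ < γ → ∃ λ α → split α ≡ inj₁ δ) → ∃ λ α → split α ≡ inj₁ γ
      reach γ ih with em {∃ λ δ → next δ ≡ γ}
      ... | no ∄δ          = γ , trans (split-unfold γ) (splitDec-limit em _ ∄δ)
      ... | yes (δ , refl) with ih (<-next δ)
      ...   | α , eq = next (next α) , split-next (split-next eq)

    split-surjective : StrictlySurjective _≡_ split
    split-surjective (inj₁ γ) = split-inj₁ γ
    split-surjective (inj₂ γ) with split-inj₁ γ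
    ... | α , eq = next α , split-next eq

-- From condensations to closed systems, and from winning strategies to condensations.

module _ {L : Language ℓ} {𝕏 𝕐 : Structure L} where
  private
    module X = Structure 𝕏
    module Y = Structure 𝕐

  PC-⇒ : ∀ {f g : REL X.Carrier Y.Carrier ℓ} → f ⇒ g → PC 𝕏 𝕐 g → PC 𝕏 𝕐 f
  PC-⇒ f⇒g pc = record
    { functional = λ u v → functional (f⇒g u) (f⇒g v)
    ; injective  = λ u v → injective (f⇒g u) (f⇒g v)
    ; preserves  = λ i ps → preserves i (Pointwise.map f⇒g ps)
    }
    where open PC pc

  ≼c⇒bfs : (κ : Cardinal ℓ) → 𝕏 ≼c 𝕐 → ∃ λ Π → ClosedBackAndForth 𝕏 𝕐 κ Π
  ≼c⇒bfs κ (F , pc , total , onto) =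
    -- The singleton of `F`, with mutual inclusion in place of `f ≡ F`, which would not live at
    -- level `ℓ`.
    (λ f → (f ⇒ F) × (F ⇒ f)) ,
    record
      { nonempty = F , F∈Π
      ; ⊆PC      = λ (f⇒F , _) → PC-⇒ f⇒F pc
      ; forth    = λ (f⇒F , _) x → F , F∈Π , f⇒F , total x
      ; back     = λ (f⇒F , _) y → F , F∈Π , f⇒F , onto y
      } ,
    λ γ p _ → (F , F∈Π) , λ α → proj₁ (proj₂ (p α))
    where
    F∈Π : (F ⇒ F) × (F ⇒ F)
    F∈Π = (λ u → u) , (λ u → u)

  module _ (κ : Cardinal ℓ) (ext : Extensionality ℓ ℓ) where
    open Game 𝕏 𝕐 κ

    winning⇒≼c : (m : Cardinal.Carrier κ → MoveI) → StrictlySurjective _≡_ m →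
                 ∃ Winning → 𝕏 ≼c 𝕐
    winning⇒≼c m m-surjective (σ , winning) =
      graph play , winning follows ,
      (λ x → let α , eq = m-surjective (inj₁ x)
                 y , pair≡ = pair-inj₁ (play α) (trans (play-move α) eq)
             in y , α , pair≡) ,
      (λ y → let α , eq = m-surjective (inj₂ y)
                 x , pair≡ = pair-inj₂ (play α) (trans (play-move α) eq)
             in x , α , pair≡)
      where
      open SegmentRecursion κ {A = Step} ext (λ α h → m α , σ α h (m α))
        renaming (rec to play; rec-unfold to play-unfold)

      play-move : ∀ α → proj₁ (play α) ≡ m α
      play-move α = cong proj₁ (play-unfold α)

      -- The type of a reply depends on the move. Keeping `s` a variable lets a match on `refl`
      -- replace explicit transport along the equality of moves.
      reply≡ : ∀ {s a} (r : (a : MoveI) → MoveII a) → s ≡ (a , r a) → proj₂ s ≡ r (proj₁ s)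
      reply≡ r refl = refl

      follows : Follows σ play
      follows α = reply≡ (σ α (play ∘ value)) (play-unfold α)

      pair-inj₁ : ∀ s {x} → proj₁ s ≡ inj₁ x → ∃ λ y → pair s ≡ (x , y)
      pair-inj₁ (_ , y) refl = y , refl

      pair-inj₂ : ∀ s {y} → proj₁ s ≡ inj₂ y → ∃ λ x → pair s ≡ (x , y)
      pair-inj₂ (_ , x) refl = x , refl

  -- A winning strategy for II from a closed system.

  module Descent (κ : Cardinal ℓ) (em : ExcludedMiddle ℓ) (ext : Extensionality ℓ (suc ℓ))
                 {Π : Pred (REL X.Carrier Y.Carrier ℓ) ℓ}
                 (bfs : BackAndForth 𝕏 𝕐 Π) (closed : Closed κ (reverseInclusion Π)) where
    open Cardinal κ
    open IsStrictTotalOrder isStrictTotalOrder using (compare; _<?_) renaming (trans to <-trans)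
    open BackAndForth bfs
    open Game 𝕏 𝕐 κ

    private
      Map : Set (suc ℓ)
      Map = Σ (REL X.Carrier Y.Carrier ℓ) Π

    infix 4 _⊑_

    _⊑_ : Rel Map ℓ
    p ⊑ q = proj₁ p ⇒ proj₁ q

    record Extension (p : Map) (a : MoveI) : Set (suc ℓ) where
      field
        map      : Map
        extends  : p ⊑ map
        reply    : MoveII a
        contains : uncurry (proj₁ map) (pair (a , reply))
    open Extension

    extend : ∀ p a → Extension p a
    extend (f , f∈Π) (inj₁ x) with forth f∈Π x
    ... | g , g∈Π , f⇒g , y , gxy = record { map = g , g∈Π ; extends = f⇒g ; reply = y ; contains = gxy }
    extend (f , f∈Π) (inj₂ y) with back f∈Π y
    ... | g , g∈Π , f⇒g , x , gxy = record { map = g , g∈Π ; extends = f⇒g ; reply = x ; contains = gxy }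

    Increasing : ∀ {γ} → (Segment γ → Map) → Set ℓ
    Increasing h = ∀ α β → value α < value β → h α ⊑ h β

    -- The recursion below asks for a bound before its values are known to
    -- increase; for sequences that do not, the answer is arbitrary.
    bound : ∀ γ → (Segment γ → Map) → Map
    bound γ h with em {Increasing h}
    ... | yes inc = proj₁ (closed γ h inc)
    ... | no _    = nonempty

    ⊑-bound : ∀ γ (h : Segment γ → Map) → Increasing h → ∀ α → h α ⊑ bound γ h
    ⊑-bound γ h inc α with em {Increasing h}
    ... | yes inc′ = proj₂ (closed γ h inc′) α
    ... | no ¬inc  = contradiction inc ¬inc

    -- The moves of I alone drive the recursion: II's replies are read off from the maps and need
    -- not be recorded.
    module _ (m : Carrier → MoveI) where
      open SegmentRecursion κ {A = Map} ext (λ α h → map (extend (bound α h) (m α)))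
        renaming (rec to descent; rec-unfold to descent-unfold) public

    -- By induction on `β`: the maps below `β` already increase, so `bound` at `β` is a genuine
    -- bound, and the map at `β` extends it.
    descent-increasing : ∀ m β {α} → α < β → descent m α ⊑ descent m β
    descent-increasing m = All.wfRec wellFounded ℓ
      (λ β → ∀ {α} → α < β → descent m α ⊑ descent m β)
      λ β ih {α} α<β {x} {y} αxy → subst (λ p → proj₁ p x y) (sym (descent-unfold m β))
        (extends (extend _ (m β))
          (⊑-bound β (descent m ∘ value) (λ α α′ → ih (value< κ α′)) (α , [ α<β ]) αxy))

    -- The map at `α` is built from the moves up to and including `α`. This is what lets a strategy
    -- that sees only a history agree with the descent along the whole play.
    descent-cong : ∀ {m m′} β → (∀ {α} → α < β → m α ≡ m′ α) →
                   ∀ α → α < β → descent m α ≡ descent m′ α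
    descent-cong {m} {m′} β eq = All.wfRec wellFounded (suc ℓ)
      (λ α → α < β → descent m α ≡ descent m′ α) step
      where
      step : ∀ α → (∀ {α′} → α′ < α → α′ < β → descent m α′ ≡ descent m′ α′) →
             α < β → descent m α ≡ descent m′ α
      step α ih α<β
        rewrite descent-unfold m α | descent-unfold m′ α | eq α<β
        = cong (λ h → map (extend (bound α h) (m′ α)))
            (ext λ α′ → ih (value< κ α′) (<-trans (value< κ α′) α<β))

    -- Only the moves of I before step α affect the bound at α, so that the
    -- history below α may be continued at will.
    prolongDec : ∀ {α} → (Segment α → Step) → MoveI → ∀ β → Dec (β < α) → MoveI
    prolongDec h a β (yes β<α) = proj₁ (h (β , [ β<α ]))
    prolongDec h a β (no _)    = a

    prolong : ∀ {α} → (Segment α → Step) → MoveI → Carrier → MoveI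
    prolong {α} h a β = prolongDec h a β (β <? α)

    strategy : Strategy
    strategy α h a = reply (extend (bound α (descent (prolong h a) ∘ value)) a)

    module _ {p : Play} (follows : Follows strategy p) where
      private
        m : Carrier → MoveI
        m = proj₁ ∘ p

        prolong-play : ∀ {α} a {β} → β < α → prolong (p ∘ value {P = _< α}) a β ≡ m β
        prolong-play {α} a {β} β<α with β <? α
        ... | yes _   = refl
        ... | no β≮α = contradiction β<α β≮α

      -- Below `α` the prolonged history has the same moves of I as the play, so both descents offer
      -- the same bound at `α`.
      reply-play : ∀ α → proj₂ (p α) ≡ reply (extend (bound α (descent m ∘ value)) (m α))
      reply-play α = trans (follows α)
        (cong (λ h → reply (extend (bound α h) (m α)))
          (ext λ β → descent-cong α (prolong-play (m α)) (value β) (value< κ β)))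

      pair∈descent : ∀ α → uncurry (proj₁ (descent m α)) (pair (p α))
      pair∈descent α =
        subst (λ q → uncurry (proj₁ q) (pair (p α))) (sym (descent-unfold m α))
          (subst (λ r → uncurry (proj₁ (map extension)) (pair (m α , r))) (sym (reply-play α))
            (contains extension))
        where
        extension : Extension (bound α (descent m ∘ value)) (m α)
        extension = extend _ (m α)

      graph⇒descent : ∀ {x y} → graph p x y → ∃ λ α → proj₁ (descent m α) x y
      graph⇒descent (α , eq) = α , subst (uncurry (proj₁ (descent m α))) eq (pair∈descent α)

      directed : ∀ α β → ∃ λ γ → (descent m α ⊑ descent m γ) × (descent m β ⊑ descent m γ)
      directed α β with compare α β
      ... | tri< α<β _ _  = β , descent-increasing m β α<β , λ u → u
      ... | tri≈ _ refl _ = α , (λ u → u) , λ u → u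
      ... | tri> _ _ β<α  = α , (λ u → u) , descent-increasing m α β<α

      -- A tuple is finite, so directedness collects its pairs in one map. The empty tuple provides
      -- no stage of its own and takes `origin`.
      pointwise⇒descent : Carrier → ∀ {k l xs ys} → Pointwise (graph p) {k} {l} xs ys →
                          ∃ λ α → Pointwise (proj₁ (descent m α)) xs ys
      pointwise⇒descent origin []       = origin , []
      pointwise⇒descent origin (u ∷ us) with graph⇒descent u | pointwise⇒descent origin us
      ... | α , v | β , vs with directed α β
      ...   | γ , α⊑γ , β⊑γ = γ , α⊑γ v ∷ Pointwise.map β⊑γ vs

      -- Each clause of `PC` concerns finitely many pairs, hence can be checked in a single member
      -- of the system.
      graph-PC : Carrier → PC 𝕏 𝕐 (graph p)
      graph-PC origin = record
        { functional = functional′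
        ; injective  = injective′
        ; preserves  = λ i us → let α , vs = pointwise⇒descent origin us in PC.preserves (descent-PC α) i vs
        }
        where
        descent-PC : ∀ α → PC 𝕏 𝕐 (proj₁ (descent m α))
        descent-PC α = ⊆PC (proj₂ (descent m α))

        functional′ : ∀ {x y y′} → graph p x y → graph p x y′ → y ≡ y′
        functional′ u u′ with graph⇒descent u | graph⇒descent u′
        ... | α , v | β , v′ with directed α β
        ...   | γ , α⊑γ , β⊑γ = PC.functional (descent-PC γ) (α⊑γ v) (β⊑γ v′)

        injective′ : ∀ {x x′ y} → graph p x y → graph p x′ y → x ≡ x′
        injective′ u u′ with graph⇒descent u | graph⇒descent u′
        ... | α , v | β , v′ with directed α β
        ...   | γ , α⊑γ , β⊑γ = PC.injective (descent-PC γ) (α⊑γ v) (β⊑γ v′)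

  bfs⇒winning : (κ : Cardinal ℓ) → ExcludedMiddle ℓ → Extensionality ℓ (suc ℓ) → ω≤ κ →
                (∃ λ Π → ClosedBackAndForth 𝕏 𝕐 κ Π) → ∃ (Game.Winning 𝕏 𝕐 κ)
  bfs⇒winning κ em ext infinite (Π , bfs , closed) =
    -- The image of 0 is the stage assigned to empty tuples.
    strategy , λ follows → graph-PC follows (Injection.to infinite 0)
    where open Descent κ em ext bfs closed

-- A sequence of κ moves that exhausts both structures.

enumeration : ExcludedMiddle ℓ → (κ : Cardinal ℓ) → ω≤ κ → {A B : Set ℓ} → ∥ A ∥≡ κ → ∥ B ∥≡ κ →
              ∃ λ (m : Cardinal.Carrier κ → A ⊎ B) → StrictlySurjective _≡_ m
enumeration em κ infinite {A} {B} A≡κ B≡κ = Sum.map A.from B.from ∘ split , onto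
  where
  open Doubling κ em infinite
  module A = Inverse (⤖⇒↔ A≡κ)
  module B = Inverse (⤖⇒↔ B≡κ)

  onto : StrictlySurjective _≡_ (Sum.map A.from B.from ∘ split)
  onto (inj₁ a) with split-surjective (inj₁ (A.to a))
  ... | α , eq = α , trans (cong (Sum.map A.from B.from) eq) (cong inj₁ (A.strictlyInverseʳ a))
  onto (inj₂ b) with split-surjective (inj₂ (B.to b))
  ... | α , eq = α , trans (cong (Sum.map A.from B.from) eq) (cong inj₂ (B.strictlyInverseʳ b))

-- The cycle of implications and the symmetric version.

private
  ≼c⇔bfs⇔winning : ExcludedMiddle ℓ → Extensionality ℓ (suc ℓ) →
    {L : Language ℓ} (𝕏 𝕐 : Structure L) (κ : Cardinal ℓ) →
    ∥ Structure.Carrier 𝕏 ∥≡ κ → ∥ Structure.Carrier 𝕐 ∥≡ κ → ω≤ κ →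
    ((𝕏 ≼c 𝕐) ⇔ (∃ λ Π → ClosedBackAndForth 𝕏 𝕐 κ Π)) ×
    ((∃ λ Π → ClosedBackAndForth 𝕏 𝕐 κ Π) ⇔ (∃ λ σ → Game.Winning 𝕏 𝕐 κ σ))
  ≼c⇔bfs⇔winning {ℓ} em ext 𝕏 𝕐 κ X≡κ Y≡κ infinite =
    -- The three implications form a cycle, so each converse is the composite of the other two.
    mk⇔ a⇒b (c⇒a ∘ b⇒c) , mk⇔ b⇒c (a⇒b ∘ c⇒a)
    where
    a⇒b : 𝕏 ≼c 𝕐 → ∃ λ Π → ClosedBackAndForth 𝕏 𝕐 κ Π
    a⇒b = ≼c⇒bfs κ

    b⇒c : (∃ λ Π → ClosedBackAndForth 𝕏 𝕐 κ Π) → ∃ (Game.Winning 𝕏 𝕐 κ)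
    b⇒c = bfs⇒winning κ em ext infinite

    c⇒a : ∃ (Game.Winning 𝕏 𝕐 κ) → 𝕏 ≼c 𝕐
    c⇒a = uncurry (winning⇒≼c κ (lower-extensionality ℓ (suc ℓ) ext)) (enumeration em κ infinite X≡κ Y≡κ)

theorem3p1 : ∀ {ℓ : Level} →
    ExcludedMiddle (suc ℓ) → Extensionality (suc ℓ) (suc ℓ) →
    (L : Language ℓ) (𝕏 𝕐 : Structure L) (κ : Cardinal ℓ) →
    ∥ Structure.Carrier 𝕏 ∥≡ κ → ∥ Structure.Carrier 𝕐 ∥≡ κ → ω≤ κ →
    (((𝕏 ≼c 𝕐) ⇔ (∃ λ Π → ClosedBackAndForth 𝕏 𝕐 κ Π)) ×
    ((∃ λ Π → ClosedBackAndForth 𝕏 𝕐 κ Π) ⇔ (∃ λ σ → Game.Winning 𝕏 𝕐 κ σ)))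
    ×
    (((𝕏 ∼c 𝕐) ⇔
    ((∃ λ Π → ClosedBackAndForth 𝕏 𝕐 κ Π) × (∃ λ Π → ClosedBackAndForth 𝕐 𝕏 κ Π))) ×
    (((∃ λ Π → ClosedBackAndForth 𝕏 𝕐 κ Π) × (∃ λ Π → ClosedBackAndForth 𝕐 𝕏 κ Π)) ⇔
    ((∃ λ σ → Game.Winning 𝕏 𝕐 κ σ) × (∃ λ σ → Game.Winning 𝕐 𝕏 κ σ))))
theorem3p1 {ℓ} em ext L 𝕏 𝕐 κ X≡κ Y≡κ infinite =
  -- The second triple is the componentwise product of the first one for the two orders of the
  -- structures.
  (a⇔b , b⇔c) , (a⇔b ×-⇔ a⇔b′) , (b⇔c ×-⇔ b⇔c′)
  where
  em₀ : ExcludedMiddle ℓ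
  em₀ {P} = map′ lower lift (em {Lift (suc ℓ) P})

  ext₀ : Extensionality ℓ (suc ℓ)
  ext₀ = lower-extensionality (suc ℓ) (suc ℓ) ext

  a⇔b  = proj₁ (≼c⇔bfs⇔winning em₀ ext₀ 𝕏 𝕐 κ X≡κ Y≡κ infinite)
  b⇔c  = proj₂ (≼c⇔bfs⇔winning em₀ ext₀ 𝕏 𝕐 κ X≡κ Y≡κ infinite)
  a⇔b′ = proj₁ (≼c⇔bfs⇔winning em₀ ext₀ 𝕐 𝕏 κ Y≡κ X≡κ infinite)
  b⇔c′ = proj₂ (≼c⇔bfs⇔winning em₀ ext₀ 𝕐 𝕏 κ Y≡κ X≡κ infinite)
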